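{- Let $n$ be a sufficiently large integer and let $q = q(n) \geq 0.49 n$ be an integer. Then, playing the $(q:1)$ Waiter-Client game on $E(K_n)$, Client has a strategy to ensure that, at the end of the game, the minimum degree of his graph is at most one.
   Context: The $(q:1)$ Waiter-Client game on $E(K_n)$ (for a positive integer $q$) is the following two-player perfect information game. In each round, Waiter offers Client exactly $q+1$ edges of the complete graph $K_n$ which have not been claimed before; Client chooses one of these edges, which he keeps, and the remaining $q$ edges are claimed by Waiter. If fewer than $q+1$ unclaimed edges remain, all of them are claimed by Waiter. The game ends when all edges of $K_n$ have been claimed. Client's graph is the graph with vertex set $V(K_n)$ whose edges are all the edges claimed by Client. -}

module Defs where

open import Data.Fin using (Fin; _<_; _<?_)
import Data.Fin.Properties as Fin
open import Data.List using (List; []; _∷_; _++_; length; map; mapMaybe; filter; allFin; cartesianProduct)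
open import Data.List.Extrema.Nat using (min)
import Data.List.Membership.DecPropositional as DecMembership
open import Data.List.Membership.Propositional using (_∉_)
open import Data.Maybe using (Maybe; just; nothing)
open import Data.Nat using (ℕ; suc)
import Data.Nat as ℕ
open import Data.Product using (_×_; _,_; ∃-syntax)
open import Data.Sum using (_⊎_)
open import Data.Vec using (Vec; lookup; removeAt; toList)
open import Data.Vec.Relation.Unary.All using (All)
open import Data.Vec.Relation.Unary.Unique.Propositional using (Unique)
open import Relation.Binary.Definitions using (DecidableEquality)
open import Relation.Binary.PropositionalEquality using (_≡_; refl; cong)
open import Relation.Nullary using (Dec; yes; no)
open import Relation.Nullary.Decidable using (_⊎-dec_; ¬?)

-- An unordered pair of distinct vertices, stored with its smaller end first.
record Edge (n : ℕ) : Set where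
  constructor edge
  field
    lo hi : Fin n
    lo<hi : lo < hi

open Edge public

infix 4 _≟ᴱ_

_≟ᴱ_ : ∀ {n} → DecidableEquality (Edge n)
edge a b a<b ≟ᴱ edge c d c<d with a Fin.≟ c | b Fin.≟ d
... | yes refl | yes refl = yes (cong (edge a b) (Fin.<-irrelevant a<b c<d))
... | no  a≢c  | _        = no λ { refl → a≢c refl }
... | yes _    | no  b≢d  = no λ { refl → b≢d refl }

completeEdges : ∀ n → List (Edge n)
completeEdges n = mapMaybe toEdge (cartesianProduct (allFin n) (allFin n))
  where
  toEdge : Fin n × Fin n → Maybe (Edge n)
  toEdge (u , v) with u <? v
  ... | yes u<v = just (edge u v u<v)
  ... | no  _   = nothing

-- A graph on the vertex set Fin n is given by a list of its edges.  The lists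
-- arising in the game never contain an edge twice, because offered edges are
-- distinct and previously unclaimed, so counting list entries counts edges.
Graph : ℕ → Set
Graph n = List (Edge n)

Incident : ∀ {n} → Fin n → Edge n → Set
Incident v e = v ≡ lo e ⊎ v ≡ hi e

incident? : ∀ {n} (v : Fin n) (e : Edge n) → Dec (Incident v e)
incident? v e = (v Fin.≟ lo e) ⊎-dec (v Fin.≟ hi e)

degree : ∀ {n} → Graph n → Fin n → ℕ
degree G v = length (filter (incident? v) G)

-- The first argument of min is the value for an empty list.  For n ≥ 1 it does
-- not affect the result, as every degree in a simple graph is less than n.
minDegree : ∀ {n} → Graph n → ℕ
minDegree {n} G = min n (map (degree G) (allFin n))

record Position (n : ℕ) : Set where
  constructor position
  field
    client waiter : List (Edge n)

open Position public

claimed : ∀ {n} → Position n → List (Edge n)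
claimed p = client p ++ waiter p

unclaimed : ∀ {n} → Position n → List (Edge n)
unclaimed {n} p = filter (λ e → ¬? (e ∈? claimed p)) (completeEdges n)
  where open DecMembership (_≟ᴱ_ {n}) using (_∈?_)

GameOver : ∀ {n} → Position n → Set
GameOver p = unclaimed p ≡ []

Offer : ℕ → ℕ → Set
Offer q n = Vec (Edge n) (suc q)

Legal : ∀ {q n} → Position n → Offer q n → Set
Legal p o = Unique o × All (_∉ claimed p) o

-- The rounds played so far, latest first: each is an offer together with the
-- index in it of the edge that Client chose.
History : ℕ → ℕ → Set
History q n = List (Offer q n × Fin (suc q))

-- Values on illegal offers are immaterial: they are never used in a play.
ClientStrategy : ℕ → ℕ → Set
ClientStrategy q n = History q n → Offer q n → Fin (suc q)

claim : ∀ {q n} → Position n → Offer q n → Fin (suc q) → Position n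
claim (position c w) o i = position (lookup o i ∷ c) (toList (removeAt o i) ++ w)

-- Play σ h p: some play in which Waiter moves arbitrarily and Client follows σ
-- has history h and has reached position p.
data Play {q n : ℕ} (σ : ClientStrategy q n) : History q n → Position n → Set where
  start    : Play σ [] (position [] [])
  round    : ∀ {h p} → Play σ h p → (o : Offer q n) → Legal p o →
             Play σ ((o , σ h o) ∷ h) (claim p o (σ h o))
  leftover : ∀ {h p} → Play σ h p → length (unclaimed p) ℕ.< suc q →
             Play σ h (position (client p) (unclaimed p ++ waiter p))

ClientCanEnsure : (q n : ℕ) → (Graph n → Set) → Set
ClientCanEnsure q n P =
  ∃[ σ ] (∀ {h p} → Play {q} {n} σ h p → GameOver p → P (client p))

{-# OPTIONS --safe #-}
-- Client takes an offered edge that meets a vertex of degree at least two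
-- whenever there is one.  Put Q = q + 1 and I = Σ_v |deg v − 2|.  A round in
-- which Client can follow this rule does not decrease I; any other round
-- decreases I by at most 2, but uses up Q edges inside the current set of
-- vertices of degree at most one.  That set loses at most two vertices per
-- round, so if the final minimum degree is at least two, then at some moment
-- it is a set V of k or k + 1 vertices, where k = ⌊n/4⌋.  Then I ≥ k, and the
-- set V contains at most (k + 1)²/2 edges, so that Q I ≥ Q k − (k + 1)² at the
-- end of the game.  At that point I = 2 m − 2 n, where m is the number of
-- Client's edges, and 2 Q m ≤ n².  Hence Q (2 n + k) ≤ n² + (k + 1)², which
-- contradicts Q ≥ 0.49 n.
module Submission where

open import Defs
import Algebra.Properties.CommutativeMonoid.Sum
open import Data.Bool using (if_then_else_)
open import Data.Fin using (Fin; zero; suc)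
import Data.Fin.Properties as Fin
open import Data.List using (List; []; _∷_; _++_; length; map; filter; tabulate; allFin; cartesianProduct)
open import Data.List.Extrema.Nat using (min≤xs)
open import Data.List.Membership.Propositional using (_∈_)
open import Data.List.Membership.Propositional.Properties
  using (∈-∃++; ∈-++⁺ˡ; ∈-++⁺ʳ; ∈-++⁻; ∈-map⁺; ∈-map⁻; ∈-filter⁺; ∈-allFin; ∈-cartesianProduct⁺)
open import Data.List.Properties using (length-++; length-map; length-tabulate)
open import Data.List.Relation.Binary.Disjoint.Propositional using (Disjoint)
open import Data.List.Relation.Binary.Subset.Propositional using (_⊆_)
open import Data.List.Relation.Binary.Subset.Propositional.Properties using (xs⊆ys++xs)
  renaming (++⁺ʳ to ⊆-++⁺ʳ)
open import Data.List.Relation.Unary.All as All using (All; []; _∷_)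
import Data.List.Relation.Unary.All.Properties as All
open import Data.List.Relation.Unary.Any using (here; there)
open import Data.List.Relation.Unary.AllPairs using ([]; _∷_)
open import Data.List.Relation.Unary.Unique.Propositional using (Unique)
import Data.List.Relation.Unary.Unique.Propositional.Properties as Unique
open import Data.Nat
  using (ℕ; zero; suc; _+_; _*_; _≤_; _<_; _≤?_; z≤n; s≤s; ∣_-_∣; _/_; _%_)
open import Data.Nat.DivMod using (m≡m%n+[m/n]*n; m%n<n; /-monoˡ-≤)
open import Data.Nat.Properties
open import Data.Nat.Tactic.RingSolver using (solve-∀)
open import Data.Product using (∃-syntax; _×_; _,_; proj₁; proj₂)
open import Data.Sum using (_⊎_; inj₁; inj₂)
open import Data.Vec using (Vec; []; _∷_; lookup; removeAt; toList)
open import Data.Vec.Properties using (length-toList)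
import Data.Vec.Relation.Unary.All as Vec
import Data.Vec.Relation.Unary.All.Properties as Vec
import Data.Vec.Relation.Unary.AllPairs as VecPairs
import Data.Vec.Relation.Unary.Unique.Propositional as VecUnique
open import Function using (_∘_)
open import Level using (Level)
open import Relation.Binary.PropositionalEquality
  using (_≡_; refl; sym; trans; cong; cong₂; subst; module ≡-Reasoning)
open import Relation.Nullary using (Dec; yes; no; does; ¬_; contradiction)
open import Relation.Nullary.Decidable using (_⊎-dec_)
open import Relation.Unary using (Pred; Decidable)

open Algebra.Properties.CommutativeMonoid.Sum +-0-commutativeMonoid
  using (sum; sum-cong-≗; sum-replicate-zero; ∑-distrib-+)

private
  variable
    a p : Level
    A : Set a
    n q : ℕ

-- Sums over Fin n

indicator : {P : Set p} → Dec P → ℕ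
indicator P? = if does P? then 1 else 0

sum-mono : {f g : Fin n → ℕ} → (∀ i → f i ≤ g i) → sum f ≤ sum g
sum-mono {zero}  f≤g = z≤n
sum-mono {suc n} f≤g = +-mono-≤ (f≤g zero) (sum-mono (f≤g ∘ suc))

sum-const : ∀ n c → sum {n} (λ _ → c) ≡ n * c
sum-const zero    c = refl
sum-const (suc n) c = cong (c +_) (sum-const n c)

length-filter-tabulate : {P : Pred A p} (P? : Decidable P) (f : Fin n → A) →
  length (filter P? (tabulate f)) ≡ sum (λ i → indicator (P? (f i)))
length-filter-tabulate {n = zero}  P? f = refl
length-filter-tabulate {n = suc n} P? f with P? (f zero)
... | yes _ = cong suc (length-filter-tabulate P? (f ∘ suc))
... | no  _ = length-filter-tabulate P? (f ∘ suc)

δ : Fin n → Fin n → ℕ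
δ u v = indicator (v Fin.≟ u)

sum-δ : (u : Fin n) → sum (δ u) ≡ 1
sum-δ {suc n} zero    = cong suc (sum-replicate-zero n)
sum-δ {suc n} (suc u) = sum-δ u

-- Duplicate-free lists

-- One occurrence of the head is cut out of `ys`; the tail still embeds in what remains, since it
-- does not contain the head.
Unique-⊆-length : {xs ys : List A} → Unique xs → xs ⊆ ys → length xs ≤ length ys
Unique-⊆-length {xs = []} _ _ = z≤n
Unique-⊆-length {xs = x ∷ xs} (x∉xs ∷ xs!) sub with ∈-∃++ (sub (here refl))
... | ys , zs , refl = begin
  suc (length xs)               ≤⟨ s≤s (Unique-⊆-length xs! sub′) ⟩
  suc (length (ys ++ zs))       ≡⟨ cong suc (length-++ ys) ⟩
  suc (length ys + length zs)   ≡⟨ +-suc (length ys) (length zs) ⟨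
  length ys + length (x ∷ zs)   ≡⟨ length-++ ys ⟨
  length (ys ++ x ∷ zs)         ∎
  where
  open ≤-Reasoning
  sub′ : xs ⊆ ys ++ zs
  sub′ y∈xs with ∈-++⁻ ys (sub (there y∈xs))
  ... | inj₁ y∈ys         = ∈-++⁺ˡ y∈ys
  ... | inj₂ (here y≡x)   = contradiction (sym y≡x) (All.lookup x∉xs y∈xs)
  ... | inj₂ (there y∈zs) = ∈-++⁺ʳ ys y∈zs

length-cartesianProduct : {B : Set p} (xs : List A) (ys : List B) →
  length (cartesianProduct xs ys) ≡ length xs * length ys
length-cartesianProduct []       ys = refl
length-cartesianProduct (x ∷ xs) ys = trans (length-++ (map (x ,_) ys))
  (cong₂ _+_ (length-map (x ,_) ys) (length-cartesianProduct xs ys))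

Unique-toList : {xs : Vec A n} → VecUnique.Unique xs → Unique (toList xs)
Unique-toList VecPairs.[]           = []
Unique-toList (x∉xs VecPairs.∷ xs!) = Vec.toList⁺ x∉xs ∷ Unique-toList xs!

toList⊆lookup∷removeAt : (xs : Vec A (suc n)) (i : Fin (suc n)) →
  toList xs ⊆ lookup xs i ∷ toList (removeAt xs i)
toList⊆lookup∷removeAt (x ∷ xs)     zero    x∈        = x∈
toList⊆lookup∷removeAt (x ∷ y ∷ xs) (suc i) (here eq) = there (here eq)
toList⊆lookup∷removeAt (x ∷ y ∷ xs) (suc i) (there z∈)
  with toList⊆lookup∷removeAt (y ∷ xs) i z∈
... | here eq  = here eq
... | there z∈′ = there (there z∈′)

-- Packings

EndsIn : List (Fin n) → Edge n → Set
EndsIn V e = lo e ∈ V × hi e ∈ V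

-- Each edge yields two ordered pairs of entries of `V`, one per orientation. The two families are
-- disjoint because `lo` is strictly below `hi`.
edges-within : {V : List (Fin n)} {L : List (Edge n)} →
  Unique L → All (EndsIn V) L → 2 * length L ≤ length V * length V
edges-within {n} {V} {L} L! L⊆V = begin
  2 * length L                                    ≡⟨ cong (length L +_) (+-identityʳ (length L)) ⟩
  length L + length L                             ≡⟨ cong₂ _+_ (length-map forth L) (length-map back L) ⟨
  length (map forth L) + length (map back L)      ≡⟨ length-++ (map forth L) ⟨
  length (map forth L ++ map back L)              ≤⟨ Unique-⊆-length pairs! pairs⊆ ⟩
  length (cartesianProduct V V)                   ≡⟨ length-cartesianProduct V V ⟩
  length V * length V                             ∎
  where
  open ≤-Reasoning
  forth back : Edge n → Fin n × Fin n
  forth e = lo e , hi e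
  back  e = hi e , lo e

  forth-injective : ∀ {d e} → forth d ≡ forth e → d ≡ e
  forth-injective {edge a b a<b} {edge .a .b a<b′} refl =
    cong (edge a b) (Fin.<-irrelevant a<b a<b′)

  back-injective : ∀ {d e} → back d ≡ back e → d ≡ e
  back-injective eq = forth-injective (cong (λ (u , v) → v , u) eq)

  disjoint : Disjoint (map forth L) (map back L)
  disjoint (x∈forth , x∈back) with ∈-map⁻ forth x∈forth | ∈-map⁻ back x∈back
  ... | edge a b a<b , _ , refl | edge .b .a b<a , _ , refl = Fin.<-asym a<b b<a

  pairs! : Unique (map forth L ++ map back L)
  pairs! = Unique.++⁺ (Unique.map⁺ forth-injective L!) (Unique.map⁺ back-injective L!) disjoint

  pairs⊆ : map forth L ++ map back L ⊆ cartesianProduct V V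
  pairs⊆ x∈ with ∈-++⁻ (map forth L) x∈
  ... | inj₁ x∈forth with e , e∈L , refl ← ∈-map⁻ forth x∈forth
                     with lo∈V , hi∈V ← All.lookup L⊆V e∈L = ∈-cartesianProduct⁺ lo∈V hi∈V
  ... | inj₂ x∈back  with e , e∈L , refl ← ∈-map⁻ back x∈back
                     with lo∈V , hi∈V ← All.lookup L⊆V e∈L = ∈-cartesianProduct⁺ hi∈V lo∈V

-- A certificate that at least `m` claimed edges lie inside `V`. It carries its own duplicate-free
-- list, so it can grow along the play without any account of multiplicities in `claimed p`.
record Packing (p : Position n) (V : List (Fin n)) (m : ℕ) : Set where
  constructor packing
  field
    edges    : List (Edge n)
    distinct : Unique edges
    taken    : edges ⊆ claimed p
    within   : All (EndsIn V) edges
    size     : m ≤ length edges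

Packing-∅ : {p : Position n} {V : List (Fin n)} → Packing p V 0
Packing-∅ = packing [] [] (λ ()) [] z≤n

Packing-⊆ : {p p′ : Position n} {V : List (Fin n)} {m : ℕ} →
  claimed p ⊆ claimed p′ → Packing p V m → Packing p′ V m
Packing-⊆ sub (packing L L! L⊆ L⊆V m≤) = packing L L! (sub ∘ L⊆) L⊆V m≤

Packing-bound : {p : Position n} {V : List (Fin n)} {m : ℕ} →
  Packing p V m → 2 * m ≤ length V * length V
Packing-bound (packing L L! _ L⊆V m≤) = ≤-trans (*-monoʳ-≤ 2 m≤) (edges-within L! L⊆V)

offer⊆claim : (p : Position n) (o : Offer q n) (i : Fin (suc q)) →
  toList o ⊆ claimed (claim p o i)
offer⊆claim (position c w) o i e∈o with toList⊆lookup∷removeAt o i e∈o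
... | here eq  = here eq
... | there e∈ = there (∈-++⁺ʳ c (∈-++⁺ˡ e∈))

claimed⊆claim : (p : Position n) (o : Offer q n) (i : Fin (suc q)) →
  claimed p ⊆ claimed (claim p o i)
claimed⊆claim (position c w) o i e∈ with ∈-++⁻ c e∈
... | inj₁ e∈c = there (∈-++⁺ˡ e∈c)
... | inj₂ e∈w = there (∈-++⁺ʳ c (∈-++⁺ʳ (toList (removeAt o i)) e∈w))

-- Offered edges are unclaimed, hence new to the packing, and all of them become claimed whichever
-- one Client keeps.
Packing-claim : {p : Position n} {V : List (Fin n)} {m : ℕ} {o : Offer q n} (i : Fin (suc q)) →
  Legal p o → Vec.All (EndsIn V) o → Packing p V m → Packing (claim p o i) V (suc q + m)
Packing-claim {q = q} {p} {V} {m} {o} i (o! , o∉) o⊆V (packing L L! L⊆ L⊆V m≤) = packing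
  (toList o ++ L)
  (Unique.++⁺ (Unique-toList o!) L!
    (λ (e∈o , e∈L) → All.lookup (Vec.toList⁺ o∉) e∈o (L⊆ e∈L)))
  taken′
  (All.++⁺ (Vec.toList⁺ o⊆V) L⊆V)
  (begin
    suc q + m                     ≤⟨ +-monoʳ-≤ (suc q) m≤ ⟩
    suc q + length L              ≡⟨ cong (_+ length L) (length-toList o) ⟨
    length (toList o) + length L  ≡⟨ length-++ (toList o) ⟨
    length (toList o ++ L)        ∎)
  where
  open ≤-Reasoning
  taken′ : toList o ++ L ⊆ claimed (claim p o i)
  taken′ e∈ with ∈-++⁻ (toList o) e∈
  ... | inj₁ e∈o = offer⊆claim p o i e∈o
  ... | inj₂ e∈L = claimed⊆claim p o i (L⊆ e∈L)

-- Degrees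

-- An edge is not a loop, so at most one of the two `δ` terms is 1.
degree-∷ : (e : Edge n) (G : Graph n) (v : Fin n) →
  degree (e ∷ G) v ≡ δ (lo e) v + δ (hi e) v + degree G v
degree-∷ e G v with v Fin.≟ lo e | v Fin.≟ hi e
... | yes v≡lo | yes v≡hi = contradiction (lo<hi e) (Fin.<-irrefl (trans (sym v≡lo) v≡hi))
... | yes _    | no  _    = refl
... | no  _    | yes _    = refl
... | no  _    | no  _    = refl

sum-ends : (e : Edge n) → sum (λ v → δ (lo e) v + δ (hi e) v) ≡ 2
sum-ends e = trans (∑-distrib-+ (δ (lo e)) (δ (hi e))) (cong₂ _+_ (sum-δ (lo e)) (sum-δ (hi e)))

handshake : (G : Graph n) → sum (degree G) ≡ 2 * length G
handshake {n} []      = sum-replicate-zero n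
handshake {n} (e ∷ G) = begin
  sum (degree (e ∷ G))                                            ≡⟨ sum-cong-≗ (degree-∷ e G) ⟩
  sum (λ v → δ (lo e) v + δ (hi e) v + degree G v)                ≡⟨ ∑-distrib-+ (λ v → δ (lo e) v + δ (hi e) v) (degree G) ⟩
  sum (λ v → δ (lo e) v + δ (hi e) v) + sum (degree G)            ≡⟨ cong₂ _+_ (sum-ends e) (handshake G) ⟩
  2 + 2 * length G                                                ≡⟨ *-suc 2 (length G) ⟨
  2 * length (e ∷ G)                                              ∎
  where open ≡-Reasoning

degree-∷-≤ : (e : Edge n) (G : Graph n) (v : Fin n) → degree G v ≤ degree (e ∷ G) v
degree-∷-≤ e G v = subst (degree G v ≤_) (sym (degree-∷ e G v)) (m≤n+m (degree G v) _)

-- Vertices of degree at most one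

low : Graph n → List (Fin n)
low {n} G = filter (λ v → degree G v ≤? 1) (allFin n)

∈-low : (G : Graph n) (v : Fin n) → degree G v ≤ 1 → v ∈ low G
∈-low G v = ∈-filter⁺ (λ v → degree G v ≤? 1) (∈-allFin v)

length-low : (G : Graph n) → length (low G) ≡ sum (λ v → indicator (degree G v ≤? 1))
length-low G = length-filter-tabulate (λ v → degree G v ≤? 1) (λ v → v)

-- A vertex leaves the list only by gaining degree, and the gains over all vertices add up to two.
length-low-∷ : (e : Edge n) (G : Graph n) → length (low G) ≤ length (low (e ∷ G)) + 2
length-low-∷ e G = begin
  length (low G)
    ≡⟨ length-low G ⟩
  sum (λ v → indicator (degree G v ≤? 1))
    ≤⟨ sum-mono pointwise ⟩
  sum (λ v → indicator (degree (e ∷ G) v ≤? 1) + (δ (lo e) v + δ (hi e) v))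
    ≡⟨ ∑-distrib-+ (λ v → indicator (degree (e ∷ G) v ≤? 1)) (λ v → δ (lo e) v + δ (hi e) v) ⟩
  sum (λ v → indicator (degree (e ∷ G) v ≤? 1)) + sum (λ v → δ (lo e) v + δ (hi e) v)
    ≡⟨ cong₂ _+_ (sym (length-low (e ∷ G))) (sum-ends e) ⟩
  length (low (e ∷ G)) + 2
    ∎
  where
  open ≤-Reasoning
  indicator≤1 : ∀ d → indicator (d ≤? 1) ≤ 1
  indicator≤1 0             = ≤-refl
  indicator≤1 1             = ≤-refl
  indicator≤1 (suc (suc d)) = z≤n

  shift : ∀ c d → indicator (d ≤? 1) ≤ indicator (c + d ≤? 1) + c
  shift zero    d = m≤m+n _ 0
  shift (suc c) d = ≤-trans (indicator≤1 d) (m≤n⇒m≤o+n _ (s≤s z≤n))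

  pointwise : ∀ v → indicator (degree G v ≤? 1) ≤
    indicator (degree (e ∷ G) v ≤? 1) + (δ (lo e) v + δ (hi e) v)
  pointwise v rewrite degree-∷ e G v = shift (δ (lo e) v + δ (hi e) v) (degree G v)

-- Imbalance of the degrees about two

imbalance : Graph n → ℕ
imbalance G = sum (λ v → ∣ degree G v - 2 ∣)

length-low≤imbalance : (G : Graph n) → length (low G) ≤ imbalance G
length-low≤imbalance G = ≤-trans (≤-reflexive (length-low G)) (sum-mono (λ v → pointwise (degree G v)))
  where
  pointwise : ∀ d → indicator (d ≤? 1) ≤ ∣ d - 2 ∣
  pointwise 0             = s≤s z≤n
  pointwise 1             = s≤s z≤n
  pointwise (suc (suc d)) = z≤n

∣-∣-shift : ∀ b d → ∣ d - 2 ∣ ≤ ∣ b + d - 2 ∣ + b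
∣-∣-shift b d = begin
  ∣ d - 2 ∣                      ≤⟨ ∣-∣-triangle d (b + d) 2 ⟩
  ∣ d - b + d ∣ + ∣ b + d - 2 ∣  ≡⟨ cong (λ x → ∣ d - x ∣ + ∣ b + d - 2 ∣) (+-comm b d) ⟩
  ∣ d - d + b ∣ + ∣ b + d - 2 ∣  ≡⟨ cong (_+ ∣ b + d - 2 ∣) (∣m-m+n∣≡n d b) ⟩
  b + ∣ b + d - 2 ∣              ≡⟨ +-comm b _ ⟩
  ∣ b + d - 2 ∣ + b              ∎
  where open ≤-Reasoning

-- The price of a round in which no offered edge meets a saturated vertex: each of the two ends
-- moves its term by at most one.
imbalance-∷ : (e : Edge n) (G : Graph n) → imbalance G ≤ imbalance (e ∷ G) + 2
imbalance-∷ e G = begin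
  imbalance G
    ≤⟨ sum-mono pointwise ⟩
  sum (λ v → ∣ degree (e ∷ G) v - 2 ∣ + (δ (lo e) v + δ (hi e) v))
    ≡⟨ ∑-distrib-+ (λ v → ∣ degree (e ∷ G) v - 2 ∣) (λ v → δ (lo e) v + δ (hi e) v) ⟩
  imbalance (e ∷ G) + sum (λ v → δ (lo e) v + δ (hi e) v)
    ≡⟨ cong (imbalance (e ∷ G) +_) (sum-ends e) ⟩
  imbalance (e ∷ G) + 2
    ∎
  where
  open ≤-Reasoning
  pointwise : ∀ v → ∣ degree G v - 2 ∣ ≤ ∣ degree (e ∷ G) v - 2 ∣ + (δ (lo e) v + δ (hi e) v)
  pointwise v rewrite degree-∷ e G v = ∣-∣-shift (δ (lo e) v + δ (hi e) v) (degree G v)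

-- The growth of |deg s − 2| at the saturated end s pays for the possible loss
-- at the other end t.
imbalance-mono : (G G′ : Graph n) {s t : Fin n} → 2 ≤ degree G s →
  (∀ v → degree G′ v ≡ δ s v + δ t v + degree G v) → imbalance G ≤ imbalance G′
-- The extra 1 is the sum of `δ s` on the left and of `δ t` on the right, which makes the comparison
-- pointwise and free of subtraction.
imbalance-mono G G′ {s} {t} 2≤deg grow = +-cancelʳ-≤ 1 _ _ (begin
  imbalance G + 1                                ≡⟨ cong (imbalance G +_) (sum-δ s) ⟨
  imbalance G + sum (δ s)                        ≡⟨ ∑-distrib-+ (λ v → ∣ degree G v - 2 ∣) (δ s) ⟨
  sum (λ v → ∣ degree G v - 2 ∣ + δ s v)         ≤⟨ sum-mono pointwise ⟩
  sum (λ v → ∣ degree G′ v - 2 ∣ + δ t v)        ≡⟨ ∑-distrib-+ (λ v → ∣ degree G′ v - 2 ∣) (δ t) ⟩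
  imbalance G′ + sum (δ t)                       ≡⟨ cong (imbalance G′ +_) (sum-δ t) ⟩
  imbalance G′ + 1                               ∎)
  where
  open ≤-Reasoning
  saturated : ∀ b d → 2 ≤ d → ∣ d - 2 ∣ + 1 ≤ ∣ 1 + b + d - 2 ∣ + b
  saturated b (suc (suc d)) _
    rewrite +-suc b (suc d) | +-suc b d | ∣-∣-identityʳ d | +-comm d 1 =
    ≤-trans (s≤s (m≤n+m d b)) (m≤m+n _ b)
  saturated b 1 (s≤s ())

  pointwise : ∀ v → ∣ degree G v - 2 ∣ + δ s v ≤ ∣ degree G′ v - 2 ∣ + δ t v
  pointwise v rewrite grow v with v Fin.≟ s
  ... | yes refl = saturated (δ t v) (degree G v) 2≤deg
  ... | no  _    rewrite +-identityʳ ∣ degree G v - 2 ∣ = ∣-∣-shift (δ t v) (degree G v)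

-- From degree two on, the absolute value is a plain difference, so adding 2 back at every vertex
-- leaves the degree sum.
imbalance-saturated : (G : Graph n) → (∀ v → 2 ≤ degree G v) → imbalance G + n * 2 ≤ 2 * length G
imbalance-saturated {n} G 2≤deg = begin
  imbalance G + n * 2                    ≡⟨ cong (imbalance G +_) (sum-const n 2) ⟨
  imbalance G + sum {n} (λ _ → 2)        ≡⟨ ∑-distrib-+ (λ v → ∣ degree G v - 2 ∣) (λ _ → 2) ⟨
  sum (λ v → ∣ degree G v - 2 ∣ + 2)     ≤⟨ sum-mono (λ v → pointwise (degree G v) (2≤deg v)) ⟩
  sum (degree G)                         ≡⟨ handshake G ⟩
  2 * length G                           ∎
  where
  open ≤-Reasoning
  pointwise : ∀ d → 2 ≤ d → ∣ d - 2 ∣ + 2 ≤ d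
  pointwise (suc (suc d)) _ rewrite ∣-∣-identityʳ d = ≤-reflexive (+-comm d 2)
  pointwise 1 (s≤s ())

-- The strategy

MeetsSaturated : Graph n → Edge n → Set
MeetsSaturated G e = 2 ≤ degree G (lo e) ⊎ 2 ≤ degree G (hi e)

meetsSaturated? : (G : Graph n) → Decidable (MeetsSaturated G)
meetsSaturated? G e = (2 ≤? degree G (lo e)) ⊎-dec (2 ≤? degree G (hi e))

-- All that the invariants use about Client's choice. In the second case every offered edge, not
-- only the kept one, has both ends of degree at most one.
Greedy : Graph n → Offer q n → Fin (suc q) → Set
Greedy G o i = MeetsSaturated G (lookup o i) ⊎ (∀ j → ¬ MeetsSaturated G (lookup o j))

greedy : (G : Graph n) (o : Offer q n) → ∃[ i ] Greedy G o i
greedy G o with Fin.any? (λ i → meetsSaturated? G (lookup o i))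
... | yes (i , sat) = i , inj₁ sat
-- Here every choice is greedy; the first edge is taken.
... | no  none      = zero , inj₂ (λ j sat → none (j , sat))

imbalance-meetsSaturated : (e : Edge n) (G : Graph n) → MeetsSaturated G e →
  imbalance G ≤ imbalance (e ∷ G)
imbalance-meetsSaturated e G (inj₁ 2≤) = imbalance-mono G (e ∷ G) 2≤ (degree-∷ e G)
imbalance-meetsSaturated e G (inj₂ 2≤) = imbalance-mono G (e ∷ G) 2≤ (λ v →
  trans (degree-∷ e G v) (cong (_+ degree G v) (+-comm (δ (lo e) v) (δ (hi e) v))))

-- A strategy is given the history rather than the position, so Client's graph is rebuilt from it.
kept : History q n → Graph n
kept = map (λ (o , i) → lookup o i)

greedyStrategy : ClientStrategy q n
greedyStrategy h o = proj₁ (greedy (kept h) o)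

-- A round adds the same edge to both sides, and leftover edges all go to Waiter.
client≡kept : {h : History q n} {p : Position n} → Play greedyStrategy h p → client p ≡ kept h
client≡kept start              = refl
client≡kept (round play o _)   = cong (_ ∷_) (client≡kept play)
client≡kept (leftover play _)  = client≡kept play

-- Invariants of play

-- `V` is frozen as the list of low vertices at the moment of the switch; degrees only grow, so it
-- contains all later low vertices. `m` counts edges offered inside `V` since then, and the term
-- `2 * m` in `balance` pays for the imbalance lost in those rounds.
record Late (q k : ℕ) (p : Position n) : Set where
  constructor late
  field
    V        : List (Fin n)
    m        : ℕ
    small    : length V ≤ suc k
    contains : ∀ v → degree (client p) v ≤ 1 → v ∈ V
    packed   : Packing p V m
    balance  : suc q * k ≤ suc q * imbalance (client p) + 2 * m

-- Every round uses up `suc q` edges of the complete graph, so `total` bounds the number of Client's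
-- edges.
record Invariant (q k : ℕ) (p : Position n) : Set where
  constructor invariant
  field
    total : Packing p (allFin n) (suc q * length (client p))
    phase : 2 + k ≤ length (low (client p)) ⊎ Late q k p

-- If the kept edge meets a saturated vertex, the imbalance does not drop and `m` stays. Otherwise
-- the whole offer lies inside `V`: the imbalance drops by at most 2, and `m` grows by `suc q`,
-- which restores the balance exactly.
Late-claim : {k : ℕ} (p : Position n) (o : Offer q n) (i : Fin (suc q)) →
  Legal p o → Greedy (client p) o i → Late q k p → Late q k (claim p o i)
Late-claim {q = q} p@(position G w) o i legal (inj₁ sat) (late V m small contains packed balance) =
  late V m small
  (λ v d≤1 → contains v (≤-trans (degree-∷-≤ (lookup o i) G v) d≤1))
  (Packing-⊆ (claimed⊆claim p o i) packed)
  (≤-trans balance (+-monoˡ-≤ (2 * m)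
    (*-monoʳ-≤ (suc q) (imbalance-meetsSaturated (lookup o i) G sat))))
Late-claim {q = q} {k} p@(position G w) o i legal (inj₂ none) (late V m small contains packed balance) =
  late V (suc q + m) small
  (λ v d≤1 → contains v (≤-trans (degree-∷-≤ (lookup o i) G v) d≤1))
  (Packing-claim i legal (Vec.lookup⁻ ends) packed)
  (begin
    suc q * k                                                ≤⟨ balance ⟩
    suc q * imbalance G + 2 * m                              ≤⟨ +-monoˡ-≤ (2 * m) (*-monoʳ-≤ (suc q) (imbalance-∷ (lookup o i) G)) ⟩
    suc q * (imbalance (lookup o i ∷ G) + 2) + 2 * m         ≡⟨ shuffle (suc q) (imbalance (lookup o i ∷ G)) m ⟩
    suc q * imbalance (lookup o i ∷ G) + 2 * (suc q + m)     ∎)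
  where
  open ≤-Reasoning
  ends : ∀ j → EndsIn V (lookup o j)
  ends j = contains _ (≤-pred (≰⇒> (none j ∘ inj₁))) , contains _ (≤-pred (≰⇒> (none j ∘ inj₂)))

  shuffle : ∀ x y z → x * (y + 2) + 2 * z ≡ x * y + 2 * (x + z)
  shuffle = solve-∀

-- The switch: `V` is the current low list with nothing packed yet, and each low vertex contributes
-- at least one to the imbalance.
Late-low : {k : ℕ} (p : Position n) → k ≤ length (low (client p)) → length (low (client p)) ≤ suc k →
  Late q k p
Late-low {q = q} {k} p k≤ ≤k = late (low (client p)) 0 ≤k (∈-low (client p)) Packing-∅
  (≤-trans (*-monoʳ-≤ (suc q) (≤-trans k≤ (length-low≤imbalance (client p)))) (m≤m+n _ 0))

Invariant-start : {k : ℕ} → 2 + k ≤ n → Invariant q k (position {n} [] [])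
Invariant-start {n} {q} {k} 2+k≤n = invariant
  (subst (Packing _ _) (sym (*-zeroʳ (suc q))) Packing-∅)
  -- In the empty graph all `n` vertices are low.
  (inj₁ (≤-trans 2+k≤n (≤-reflexive (sym (trans (length-low {n} []) (trans (sum-const n 1) (*-identityʳ n)))))))

Invariant-claim : {k : ℕ} (p : Position n) (o : Offer q n) (i : Fin (suc q)) →
  Legal p o → Greedy (client p) o i → Invariant q k p → Invariant q k (claim p o i)
Invariant-claim {n} {q} {k} p@(position G w) o i legal choice (invariant total phase) = invariant
  (subst (Packing _ _) (sym (*-suc (suc q) (length G)))
    (Packing-claim i legal (Vec.lookup⁻ (λ j → ∈-allFin _ , ∈-allFin _)) total))
  (phase′ phase)
  where
  G′ = lookup o i ∷ G
  phase′ : 2 + k ≤ length (low G) ⊎ Late q k p → 2 + k ≤ length (low G′) ⊎ Late q k (claim p o i)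
  phase′ (inj₂ l) = inj₂ (Late-claim p o i legal choice l)
  phase′ (inj₁ 2+k≤) with 2 + k ≤? length (low G′)
  ... | yes 2+k≤′ = inj₁ 2+k≤′
  -- The low list had at least `2 + k` entries and lost at most two, so it now has `k` or `suc k`.
  ... | no  2+k≰′ = inj₂ (Late-low (claim p o i)
    (+-cancelʳ-≤ 2 k _ (≤-trans (≤-reflexive (+-comm k 2)) (≤-trans 2+k≤ (length-low-∷ (lookup o i) G))))
    (≤-pred (≰⇒> 2+k≰′)))

Invariant-leftover : {k : ℕ} (p : Position n) (es : List (Edge n)) →
  Invariant q k p → Invariant q k (position (client p) (es ++ waiter p))
Invariant-leftover {q = q} {k} (position c w) es (invariant total phase) =
  invariant (Packing-⊆ sub total) (phase′ phase)
  where
  sub : c ++ w ⊆ c ++ (es ++ w)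
  sub = ⊆-++⁺ʳ c (xs⊆ys++xs w es)
  phase′ : 2 + k ≤ length (low c) ⊎ Late q k (position c w) →
    2 + k ≤ length (low c) ⊎ Late q k (position c (es ++ w))
  phase′ (inj₁ 2+k≤) = inj₁ 2+k≤
  phase′ (inj₂ (late V m small contains packed balance)) =
    inj₂ (late V m small contains (Packing-⊆ sub packed) balance)

Invariant-play : {k : ℕ} {h : History q n} {p : Position n} → 2 + k ≤ n →
  Play greedyStrategy h p → Invariant q k p
Invariant-play 2+k≤n start = Invariant-start 2+k≤n
-- The strategy chooses by `kept h`; the rewrite turns this into a choice by `client p`.
Invariant-play 2+k≤n (round {p = p} play o legal) rewrite sym (client≡kept play) =
  Invariant-claim p o _ legal (proj₂ (greedy (client p) o)) (Invariant-play 2+k≤n play)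
Invariant-play 2+k≤n (leftover {p = p} play _) =
  Invariant-leftover p (unclaimed p) (Invariant-play 2+k≤n play)

-- No vertex is low, so the play is in its late phase. Adding `n * 2` to the imbalance in `balance`
-- gives at most twice the number of Client's edges, and the two packings bound the result by pairs
-- of all vertices and pairs in `V`.
Invariant-saturated : {k : ℕ} (p : Position n) → Invariant q k p → (∀ v → 2 ≤ degree (client p) v) →
  suc q * (k + n * 2) ≤ n * n + suc k * suc k
Invariant-saturated {n} {q} {k} p (invariant total (inj₁ 2+k≤)) 2≤deg =
  contradiction low≤0 (<⇒≱ (≤-trans (s≤s z≤n) 2+k≤))
  where
  open ≤-Reasoning
  indicator≤0 : ∀ d → 2 ≤ d → indicator (d ≤? 1) ≤ 0
  indicator≤0 (suc (suc d)) _ = z≤n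
  indicator≤0 1 (s≤s ())
  low≤0 : length (low (client p)) ≤ 0
  low≤0 = begin
    length (low (client p))                            ≡⟨ length-low (client p) ⟩
    sum (λ v → indicator (degree (client p) v ≤? 1))   ≤⟨ sum-mono (λ v → indicator≤0 _ (2≤deg v)) ⟩
    sum {n} (λ _ → 0)                                  ≡⟨ sum-replicate-zero n ⟩
    0                                                  ∎
Invariant-saturated {n} {q} {k} p (invariant total (inj₂ (late V m small _ packed balance))) 2≤deg = begin
  Q * (k + n * 2)                      ≡⟨ *-distribˡ-+ Q k (n * 2) ⟩
  Q * k + Q * (n * 2)                  ≤⟨ +-monoˡ-≤ _ balance ⟩
  Q * I + 2 * m + Q * (n * 2)          ≡⟨ shuffle Q I m n ⟩
  Q * (I + n * 2) + 2 * m              ≤⟨ +-mono-≤ (*-monoʳ-≤ Q (imbalance-saturated G 2≤deg)) (Packing-bound packed) ⟩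
  Q * (2 * length G) + length V * length V
                                       ≡⟨ cong (_+ length V * length V) (swap Q (length G)) ⟩
  2 * (Q * length G) + length V * length V
                                       ≤⟨ +-mono-≤ (Packing-bound total) (*-mono-≤ small small) ⟩
  length (allFin n) * length (allFin n) + suc k * suc k
                                       ≡⟨ cong (λ x → x * x + suc k * suc k) (length-tabulate {n = n} (λ v → v)) ⟩
  n * n + suc k * suc k                ∎
  where
  open ≤-Reasoning
  G = client p
  I = imbalance G
  Q = suc q
  shuffle : ∀ x y z w → x * y + 2 * z + x * (w * 2) ≡ x * (y + w * 2) + 2 * z
  shuffle = solve-∀
  swap : ∀ x y → x * (2 * y) ≡ 2 * (x * y)
  swap = solve-∀

-- Numerical estimate and conclusion

-- For `n` near `k * 4` the leading terms are 1700 k² on the left and 1764 k² on the right; the gap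
-- of 64 k² absorbs the lower terms once `k` is at least 4.
quarter-bound : ∀ k r → 4 ≤ k → r ≤ 3 → let n = r + k * 4 in
  100 * (n * n + suc k * suc k) < 49 * n * (k + n * 2)
quarter-bound k r 4≤k r≤3 with j , refl ← m≤n⇒∃[o]m+o≡n 4≤k = begin-strict
  100 * (N * N + suc k * suc k)                                      ≡⟨ split N k ⟩
  -- Bounding one factor `N` by `3 + k * 4` avoids a negative square of `r` in the difference of the
  -- two sides.
  98 * (N * N) + (2 * (N * N) + 100 * (suc k * suc k))               ≤⟨ +-monoʳ-≤ (98 * (N * N)) (+-monoˡ-≤ (100 * (suc k * suc k)) (*-monoʳ-≤ 2 (*-monoʳ-≤ N (+-monoˡ-≤ (k * 4) r≤3)))) ⟩
  -- The difference, less one for strictness, expanded at `k = 4 + j`: all its coefficients are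
  -- nonnegative.
  98 * (N * N) + (2 * (N * (3 + k * 4)) + 100 * (suc k * suc k))     <⟨ +-monoʳ-< (98 * (N * N)) (m≤m+n _ (64 * (j * j) + 288 * j + 27 + r * (41 * j + 158))) ⟩
  98 * (N * N) + (suc (2 * (N * (3 + k * 4)) + 100 * (suc k * suc k)) + (64 * (j * j) + 288 * j + 27 + r * (41 * j + 158)))
                                                                     ≡⟨ collect j r ⟩
  49 * N * (k + N * 2)                                               ∎
  where
  open ≤-Reasoning
  N = r + k * 4
  split : ∀ n k → 100 * (n * n + suc k * suc k) ≡ 98 * (n * n) + (2 * (n * n) + 100 * (suc k * suc k))
  split = solve-∀
  collect : ∀ j r → let k = 4 + j; n = r + k * 4 in
    98 * (n * n) + (suc (2 * (n * (3 + k * 4)) + 100 * (suc k * suc k)) + (64 * (j * j) + 288 * j + 27 + r * (41 * j + 158)))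
      ≡ 49 * n * (k + n * 2)
  collect = solve-∀

minDegree≤degree : (G : Graph n) (v : Fin n) → minDegree G ≤ degree G v
minDegree≤degree {n} G v =
  All.lookup (min≤xs n (map (degree G) (allFin n))) (∈-map⁺ (degree G) (∈-allFin v))

proposition1p5 : ∃[ N ] (∀ (n q : ℕ) → N ≤ n → 1 ≤ q → 49 * n ≤ 100 * q →
    ClientCanEnsure q n (λ G → minDegree G ≤ 1))
-- The bound 16 gives `4 ≤ n / 4`; at `k = 4` and `r = 0` the slack 64 k² - 224 k - 100 in
-- `quarter-bound` is 28, while at `k = 3` it would be negative.
proposition1p5 = 16 , λ n q 16≤n _ 49n≤100q → greedyStrategy , λ {h} {p} play _ →
  ≮⇒≥ λ 1<minDegree →
    let
      k = n / 4
      4≤k : 4 ≤ k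
      4≤k = /-monoˡ-≤ 4 16≤n
      n≡ : n ≡ n % 4 + k * 4
      n≡ = m≡m%n+[m/n]*n n 4
      2+k≤n : 2 + k ≤ n
      2+k≤n = begin
        2 + k               ≤⟨ +-monoˡ-≤ k (≤-trans (s≤s (s≤s z≤n)) 4≤k) ⟩
        k + k               ≤⟨ +-monoʳ-≤ k (m≤m+n k _) ⟩
        4 * k               ≡⟨ *-comm 4 k ⟩
        k * 4               ≤⟨ m≤n+m (k * 4) (n % 4) ⟩
        n % 4 + k * 4       ≡⟨ n≡ ⟨
        n                   ∎
      saturated : suc q * (k + n * 2) ≤ n * n + suc k * suc k
      saturated = Invariant-saturated p (Invariant-play 2+k≤n play)
        (λ v → ≤-trans 1<minDegree (minDegree≤degree (client p) v))
      dense : 49 * n * (k + n * 2) ≤ 100 * (n * n + suc k * suc k)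
      dense = begin
        -- The hypothesis bounds `q`, whereas the count of edges per round is `suc q`.
        49 * n * (k + n * 2)               ≤⟨ *-monoˡ-≤ (k + n * 2) (≤-trans 49n≤100q (*-monoʳ-≤ 100 (n≤1+n q))) ⟩
        100 * suc q * (k + n * 2)          ≡⟨ *-assoc 100 (suc q) (k + n * 2) ⟩
        100 * (suc q * (k + n * 2))        ≤⟨ *-monoʳ-≤ 100 saturated ⟩
        100 * (n * n + suc k * suc k)      ∎
      sparse : 100 * (n * n + suc k * suc k) < 49 * n * (k + n * 2)
      sparse = subst (λ n → 100 * (n * n + suc k * suc k) < 49 * n * (k + n * 2)) (sym n≡)
        (quarter-bound k (n % 4) 4≤k (≤-pred (m%n<n n 4)))
    in <⇒≱ sparse dense
  where open ≤-Reasoning
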